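{- Let ${\cal P}={\cal P}_{in}\cup{\cal P}_{out}$, let $\gamma$ be an assumption formula, let $D$ be a flagging monitor over $2^{{\cal P}_{in}}$, and let $\pi=\gamma\rightarrow\pi'$ where either $\pi'=D{:}\phi$ with $\phi$ an LTL formula (simple trigger), or $\pi'=(D;\varphi)^*$ with $\varphi$ a co-safety LTL formula (repeating trigger). Let $t(\pi)$ denote $\gamma\rightarrow\phi$ in the first case and $\gamma\rightarrow\varphi$ in the second. Let $C_{t(\pi)}$ be a Mealy machine that realises $t(\pi)$ in the simple-trigger case, and that tightly realises $t(\pi)$ in the repeating-trigger case. Then there is a Mealy machine (built from $D$ and $C_{t(\pi)}$) that realises $\pi$.
   Context: Traces $\sigma=\sigma_0\sigma_1\cdots$ have letters $\sigma_i\subseteq{\cal P}$; $\sigma_{i,j}=\sigma_i\cdots\sigma_j$, $\sigma_{i,\infty}$ the suffix from $i$. LTL: $\phi ::= \mathit{tt}\mid\mathit{ff}\mid e\mid\neg e\mid\phi\wedge\phi\mid\phi\vee\phi\mid X\phi\mid\phi U\phi\mid G\phi$, standard infinite-trace semantics; co-safety: no $G$. Finite semantics of co-safety formulas on $\sigma_{i,j}$ ($j<\infty$): atoms/Booleans at position $i$; $X\varphi$ iff $j>i$ and $\sigma_{i+1,j}\vdash\varphi$; $\varphi U\psi$ iff some $l\in[i,j]$ has $\sigma_{l,j}\vdash\psi$ and $\sigma_{k,j}\vdash\varphi$ for $k\in[i,l)$. Tight satisfaction $\sigma_{i,j}\Vdash\varphi$: $\sigma_{i,j}\vdash\varphi$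 and $\sigma_{i,k}\not\vdash\varphi$ for all $i\le k<j$. Assumptions: $\alpha ::= \mathit{tt}\mid\mathit{ff}\mid a\mid\neg\alpha\mid\alpha\wedge\alpha\mid\alpha\vee\alpha$; $\beta ::= \alpha\mid X\alpha\mid\beta\wedge\beta\mid\beta\vee\beta$; $\gamma ::= G\beta\mid GF\alpha\mid\gamma\wedge\gamma$. Flagging monitor over $\Sigma=2^{{\cal P}_{in}}$: $D=\langle \Sigma, \mathbb{V}, \Theta, Q, \theta_0, q_0, F, \perp, \rightarrow\rangle$ with typed variables $\mathbb{V}$ (arbitrary domains), valuations $\Theta$, finite states $Q$, initial valuation $\theta_0$, initial state $q_0$, flagging states $F\subseteq Q\setminus\{q_0\}$, sink $\perp$, deterministic transitions $q\xrightarrow{g\mapsto a}q'$ ($q\ne\perp$), guards $g:\Sigma\times\Theta\to\{\mathit{true},\mathit{false}\}$, actions $a:\Sigma\times\Theta\to\Theta$. Semantics on $(q,\theta)$ reading $E$: (1) if $q\notin F\cup\{\perp\}$ and a transition from $q$ has true guard, take it and set the valuation to $a(E,\theta)$; (2) if $q\notin F\cup\{\perp\}$ and no guard holds, stay; (3) $\perp$ stays; (4) a state in $F$ moves to $\perp$. On traces over $2^{\cal P}$ the monitor reads $\sigma_i\cap{\cal P}_{in}$. $\sigma_{i,j}\Vdash D$ iff the run from $(q_0,\theta_0)$ on $\sigma_i,\dots,\sigma_j$ ends in $F$. Semantics of triggers: $\sigma_{i,\infty}\vdash D{:}\phi$ iff for all $j\ge i$, $\sigma_{i,j}\Vdash D$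 implies $\sigma_{j,\infty}\vdash\phi$. $\sigma_{i,k}\vdash D;\varphi$ iff some $j\in[i,k]$ has $\sigma_{i,j}\Vdash D$ and $\sigma_{j,k}\Vdash\varphi$. Restart points: $0$ is one; if $p$ is one and $\sigma_{p,k}\vdash D;\varphi$ then $k+1$ is one. $\sigma\vdash(D;\varphi)^*$ iff for every restart point $p$ and every $i\ge p$ with $\sigma_{p,i}\Vdash D$ there is $k\ge i$ with $\sigma_{p,k}\vdash D;\varphi$. $\sigma\vdash\gamma\rightarrow\pi'$ iff $\sigma\vdash\gamma$ implies $\sigma_{0,\infty}\vdash\pi'$. Mealy machine: $C=\langle S,s_0,2^{{\cal P}_{in}},2^{{\cal P}_{out}},\rightarrow,F\rangle$, complete deterministic $\rightarrow:S\times2^{{\cal P}_{in}}\to2^{{\cal P}_{out}}\times S$, accepting states $F$. A run $s_0s_1\cdots$ with $s_i\xrightarrow{I_i/O_i}s_{i+1}$ produces $w$ with $w_i=I_i\cup O_i$; $C$ accepts a prefix $u$ if $s_{|u|}\in F$. $C$ realises a formula if every produced word satisfies it. $C$ tightly realises $\gamma\rightarrow\varphi$ ($\varphi$ co-safety) if it realises it and for each produced $w$ with $w\vdash\gamma$ there is a prefix $u$ of $w$ accepted by $C$, tightly satisfying $\varphi$, with no strict prefix of $u$ accepted by $C$. -}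

module Defs where

open import Data.Bool using (Bool; true; false; T; _∧_; _∨_)
open import Data.Bool.Properties using (T-∧)
open import Data.Empty using (⊥)
open import Data.Fin using (Fin)
open import Data.Nat using (ℕ; zero; suc; _≤_; _<_)
open import Data.Product using (_×_; _,_; ∃-syntax; proj₁; proj₂)
open import Data.Sum using (_⊎_)
open import Data.Unit using (⊤)
open import Function using (Equivalence)
open import Relation.Binary.PropositionalEquality using (_≡_; _≢_)
open import Relation.Nullary using (¬_)

-- Subsets are given by characteristic functions.

Subset : Set → Set
Subset A = A → Bool

module _ {A : Set} where

  infix 4 _∈_ _∉_ _⊆_
  infixr 6 _∪_
  infixr 7 _∩_

  _∈_ _∉_ : A → Subset A → Set
  x ∈ U = T (U x)
  x ∉ U = ¬ (x ∈ U)

  _⊆_ : Subset A → Subset A → Set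
  U ⊆ V = ∀ x → x ∈ U → x ∈ V

  _∪_ _∩_ : Subset A → Subset A → Subset A
  (U ∪ V) x = U x ∨ V x
  (U ∩ V) x = U x ∧ V x

-- The power set 2^U of a subset U of A.

record 2^ {A : Set} (U : Subset A) : Set where
  constructor _since_
  field
    set   : Subset A
    .incl : set ⊆ U

open 2^ public

_restrictedTo_ : {A : Set} → Subset A → (U : Subset A) → 2^ U
V restrictedTo U = (V ∩ U) since λ x x∈ → proj₂ (Equivalence.to (T-∧ {V x} {U x}) x∈)

Trace : Set → Set
Trace P = ℕ → Subset P

------------------------------------------------------------------------
-- LTL

data Fragment : Set where
  full co-safety : Fragment

-- Every constructor but G is available in both fragments, so that
-- LTL P co-safety consists of exactly the formulas without G.

data LTL (P : Set) : Fragment → Set where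
  tt ff   : ∀ {f} → LTL P f
  atom    : ∀ {f} → P → LTL P f
  ¬atom   : ∀ {f} → P → LTL P f
  _and_   : ∀ {f} → LTL P f → LTL P f → LTL P f
  _or_    : ∀ {f} → LTL P f → LTL P f → LTL P f
  X       : ∀ {f} → LTL P f → LTL P f
  _U_     : ∀ {f} → LTL P f → LTL P f → LTL P f
  G       : LTL P full → LTL P full

module _ {P : Set} where

  -- σ from i ⊢ φ is σ_{i,∞} ⊢ φ.

  infix 4 _from_⊢_
  _from_⊢_ : ∀ {f} → Trace P → ℕ → LTL P f → Set
  σ from i ⊢ tt        = ⊤
  σ from i ⊢ ff        = ⊥
  σ from i ⊢ atom e    = e ∈ σ i
  σ from i ⊢ ¬atom e   = e ∉ σ i
  σ from i ⊢ (φ and ψ) = (σ from i ⊢ φ) × (σ from i ⊢ ψ)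
  σ from i ⊢ (φ or ψ)  = (σ from i ⊢ φ) ⊎ (σ from i ⊢ ψ)
  σ from i ⊢ X φ       = σ from suc i ⊢ φ
  σ from i ⊢ (φ U ψ)   = ∃[ l ] i ≤ l × (σ from l ⊢ ψ) × (∀ k → i ≤ k → k < l → σ from k ⊢ φ)
  σ from i ⊢ G φ       = ∀ l → i ≤ l → σ from l ⊢ φ

  -- σ [ i ⋯ j ]⊢ φ is σ_{i,j} ⊢ φ; it is meant for i ≤ j only.

  infix 4 _[_⋯_]⊢_ _[_⋯_]⊩_
  _[_⋯_]⊢_ : Trace P → ℕ → ℕ → LTL P co-safety → Set
  σ [ i ⋯ j ]⊢ tt        = ⊤
  σ [ i ⋯ j ]⊢ ff        = ⊥
  σ [ i ⋯ j ]⊢ atom e    = e ∈ σ i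
  σ [ i ⋯ j ]⊢ ¬atom e   = e ∉ σ i
  σ [ i ⋯ j ]⊢ (φ and ψ) = (σ [ i ⋯ j ]⊢ φ) × (σ [ i ⋯ j ]⊢ ψ)
  σ [ i ⋯ j ]⊢ (φ or ψ)  = (σ [ i ⋯ j ]⊢ φ) ⊎ (σ [ i ⋯ j ]⊢ ψ)
  σ [ i ⋯ j ]⊢ X φ       = i < j × (σ [ suc i ⋯ j ]⊢ φ)
  σ [ i ⋯ j ]⊢ (φ U ψ)   = ∃[ l ] i ≤ l × l ≤ j × (σ [ l ⋯ j ]⊢ ψ)
                                × (∀ k → i ≤ k → k < l → σ [ k ⋯ j ]⊢ φ)

  _[_⋯_]⊩_ : Trace P → ℕ → ℕ → LTL P co-safety → Set
  σ [ i ⋯ j ]⊩ φ = (σ [ i ⋯ j ]⊢ φ) × (∀ k → i ≤ k → k < j → ¬ (σ [ i ⋯ k ]⊢ φ))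

------------------------------------------------------------------------
-- Assumptions: the grammars α, β and γ

data StateFormula (P : Set) : Set where
  tt ff       : StateFormula P
  atom        : P → StateFormula P
  not         : StateFormula P → StateFormula P
  _and_ _or_  : StateFormula P → StateFormula P → StateFormula P

data StepFormula (P : Set) : Set where
  now         : StateFormula P → StepFormula P
  X           : StateFormula P → StepFormula P
  _and_ _or_  : StepFormula P → StepFormula P → StepFormula P

data Assumption (P : Set) : Set where
  G     : StepFormula P → Assumption P
  GF    : StateFormula P → Assumption P
  _and_ : Assumption P → Assumption P → Assumption P

module _ {P : Set} where

  infix 4 _from_⊢α_ _from_⊢β_ _from_⊢γ_

  _from_⊢α_ : Trace P → ℕ → StateFormula P → Set
  σ from i ⊢α tt        = ⊤
  σ from i ⊢α ff        = ⊥
  σ from i ⊢α atom a    = a ∈ σ i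
  σ from i ⊢α not α     = ¬ (σ from i ⊢α α)
  σ from i ⊢α (α and δ) = (σ from i ⊢α α) × (σ from i ⊢α δ)
  σ from i ⊢α (α or δ)  = (σ from i ⊢α α) ⊎ (σ from i ⊢α δ)

  _from_⊢β_ : Trace P → ℕ → StepFormula P → Set
  σ from i ⊢β now α     = σ from i ⊢α α
  σ from i ⊢β X α       = σ from suc i ⊢α α
  σ from i ⊢β (β and δ) = (σ from i ⊢β β) × (σ from i ⊢β δ)
  σ from i ⊢β (β or δ)  = (σ from i ⊢β β) ⊎ (σ from i ⊢β δ)

  _from_⊢γ_ : Trace P → ℕ → Assumption P → Set
  σ from i ⊢γ G β       = ∀ l → i ≤ l → σ from l ⊢β β
  σ from i ⊢γ GF α      = ∀ l → i ≤ l → ∃[ m ] l ≤ m × (σ from m ⊢α α)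
  σ from i ⊢γ (γ and δ) = (σ from i ⊢γ γ) × (σ from i ⊢γ δ)

------------------------------------------------------------------------
-- Flagging monitors

record Monitor {P : Set} (Pin : Subset P) : Set₁ where
  field
    Var : Set
    Dom : Var → Set

  Valuation : Set
  Valuation = (v : Var) → Dom v

  field
    ∣Q∣ : ℕ

  Q : Set
  Q = Fin ∣Q∣

  field
    θ₀      : Valuation
    q₀ sink : Q
    F       : Subset Q
    q₀∉F    : q₀ ∉ F
    -- Makes the rules `sinking` and `flagged` below mutually exclusive.
    sink∉F  : sink ∉ F

    -- The transitions  source t --[ guard t ↦ action t ]--> target t
    Transition    : Set
    source target : Transition → Q
    guard         : Transition → 2^ Pin → Valuation → Bool
    action        : Transition → 2^ Pin → Valuation → Valuation
    source≢sink   : ∀ t → source t ≢ sink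
    deterministic : ∀ t u E θ → source t ≡ source u →
                    guard t E θ ≡ true → guard u E θ ≡ true → t ≡ u

  Config : Set
  Config = Q × Valuation

  data Step : Config → 2^ Pin → Config → Set where
    fire    : ∀ {θ E} t → source t ∉ F → source t ≢ sink → guard t E θ ≡ true →
              Step (source t , θ) E (target t , action t E θ)
    idle    : ∀ {q θ E} → q ∉ F → q ≢ sink →
              (∀ t → source t ≡ q → guard t E θ ≡ false) →
              Step (q , θ) E (q , θ)
    sinking : ∀ {θ E} → Step (sink , θ) E (sink , θ)
    flagged : ∀ {q θ E} → q ∈ F → Step (q , θ) E (sink , θ)

  -- Run σ i j c: reading σ_i, …, σ_j from the initial configuration leads to c.

  data Run (σ : Trace P) (i : ℕ) : ℕ → Config → Set where
    first : ∀ {c} → Step (q₀ , θ₀) (σ i restrictedTo Pin) c → Run σ i i c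
    next  : ∀ {j c d} → Run σ i j c → Step c (σ (suc j) restrictedTo Pin) d → Run σ i (suc j) d

module _ {P : Set} {Pin : Subset P} where

  infix 4 _[_⋯_]⊩ᴹ_ _from_⊢_∶_ _[_⋯_]⊢_⨾_ _⊢⟨_⨾_⟩*

  _[_⋯_]⊩ᴹ_ : Trace P → ℕ → ℕ → Monitor Pin → Set
  σ [ i ⋯ j ]⊩ᴹ D = ∃[ c ] Run σ i j c × proj₁ c ∈ F
    where open Monitor D

  _from_⊢_∶_ : Trace P → ℕ → Monitor Pin → LTL P full → Set
  σ from i ⊢ D ∶ φ = ∀ j → i ≤ j → σ [ i ⋯ j ]⊩ᴹ D → σ from j ⊢ φ

  _[_⋯_]⊢_⨾_ : Trace P → ℕ → ℕ → Monitor Pin → LTL P co-safety → Set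
  σ [ i ⋯ k ]⊢ D ⨾ φ = ∃[ j ] i ≤ j × j ≤ k × (σ [ i ⋯ j ]⊩ᴹ D) × (σ [ j ⋯ k ]⊩ φ)

  data RestartPoint (σ : Trace P) (D : Monitor Pin) (φ : LTL P co-safety) : ℕ → Set where
    start   : RestartPoint σ D φ zero
    restart : ∀ {p k} → RestartPoint σ D φ p → σ [ p ⋯ k ]⊢ D ⨾ φ → RestartPoint σ D φ (suc k)

  _⊢⟨_⨾_⟩* : Trace P → Monitor Pin → LTL P co-safety → Set
  σ ⊢⟨ D ⨾ φ ⟩* = ∀ p → RestartPoint σ D φ p → ∀ i → p ≤ i → σ [ p ⋯ i ]⊩ᴹ D →
                  ∃[ k ] i ≤ k × (σ [ p ⋯ k ]⊢ D ⨾ φ)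

------------------------------------------------------------------------
-- Mealy machines

record Mealy {P : Set} (Pin Pout : Subset P) : Set₁ where
  field
    S  : Set
    s₀ : S
    δ  : S → 2^ Pin → 2^ Pout × S
    F  : Subset S

  state : (ℕ → 2^ Pin) → ℕ → S
  state I zero    = s₀
  state I (suc n) = proj₂ (δ (state I n) (I n))

  output : (ℕ → 2^ Pin) → ℕ → 2^ Pout
  output I n = proj₁ (δ (state I n) (I n))

  -- The word produced by the run on the inputs I.
  word : (ℕ → 2^ Pin) → Trace P
  word I n = set (I n) ∪ set (output I n)

  -- C accepts the prefix of length n of the word produced on I.
  AcceptsPrefix : (ℕ → 2^ Pin) → ℕ → Set
  AcceptsPrefix I n = state I n ∈ F

module _ {P : Set} {Pin Pout : Subset P} where

  Realises : Mealy Pin Pout → (Trace P → Set) → Set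
  Realises C Φ = ∀ I → Φ (word I)
    where open Mealy C

  -- Tight satisfaction concerns nonempty words only, so the prefix u is
  -- w_{0,n}, of length suc n; its strict prefixes include the empty word.

  TightlyRealises : Mealy Pin Pout → Assumption P → LTL P co-safety → Set
  TightlyRealises C γ φ =
    Realises C (λ w → w from 0 ⊢γ γ → w from 0 ⊢ φ) ×
    (∀ I → word I from 0 ⊢γ γ →
       ∃[ n ] AcceptsPrefix I (suc n)
            × (word I [ 0 ⋯ n ]⊩ φ)
            × (∀ m → m < suc n → ¬ AcceptsPrefix I m))
    where open Mealy C

{-# OPTIONS --safe #-}

-- The machine for π watches D while outputting, at every step, the answer
-- that C gives to the current input in its initial state.  When D flags, the
-- letter just produced is thus already the first letter of a run of C, and
-- this run is continued.  For a repeating trigger it is abandoned, and D is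
-- started afresh, once the letters produced since the flag satisfy φ.
-- Assumptions are inherited by suffixes, so a run of C that is never abandoned
-- produces a word satisfying γ, to which the hypothesis on C applies.
--
-- Acceptance by C is not used to end a run.  Since γ may mention outputs, C
-- may accept too early in a run whose continuation by C violates γ, whereas
-- its continuation by a restarted machine satisfies γ.

module Submission where

open import Defs
open import Axiom.ExcludedMiddle using (ExcludedMiddle)
open import Data.Bool using (true; false; if_then_else_)
open import Data.Bool.Properties using (T?; ¬-not)
open import Data.Empty using (⊥)
open import Data.Fin.Properties using (_≟_)
open import Data.Nat using (ℕ; zero; suc; _+_; _∸_; _≤_; _<_; z≤n; s≤s)
open import Data.Nat.Induction using (<-rec)
open import Data.Nat.Properties using (≤-refl; ≤-trans; <⇒≤; ≤∧≢⇒<; m≤n+m; m<n⇒m<1+n; m∸n+n≡m; +-identityʳ; +-monoˡ-≤; +-monoˡ-<; +-cancelʳ-≤; +-cancelʳ-<) renaming (_≟_ to _≟ℕ_)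
open import Data.Product using (_×_; _,_; ∃-syntax; Σ-syntax; proj₁; proj₂)
open import Data.Sum using (_⊎_; inj₁; inj₂; map)
open import Level using (0ℓ)
open import Relation.Binary.PropositionalEquality using (_≡_; refl; sym; trans; cong; subst)
open import Relation.Nullary using (¬_; Dec; yes; no; contradiction)

-- Positions beyond an offset

≤⇒∃+ : ∀ {d l} → d ≤ l → ∃[ m ] l ≡ m + d
≤⇒∃+ {d} {l} d≤l = l ∸ d , sym (m∸n+n≡m d≤l)

i+d≤l⇒∃+ : ∀ i {d l} → i + d ≤ l → ∃[ m ] l ≡ m + d
i+d≤l⇒∃+ i {d} i+d≤l = ≤⇒∃+ (≤-trans (m≤n+m d i) i+d≤l)

-- Satisfaction along shifted traces

module _ {P : Set} where

  α-cong : ∀ {σ τ : Trace P} {i k} α → σ i ≡ τ k → σ from i ⊢α α → τ from k ⊢α α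
  α-cong tt        e h        = h
  α-cong (atom a)  e h        = subst (a ∈_) e h
  α-cong (not α)   e h        = λ g → h (α-cong α (sym e) g)
  α-cong (α and δ) e (h , g)  = α-cong α e h , α-cong δ e g
  α-cong (α or δ)  e          = map (α-cong α e) (α-cong δ e)

  β-cong : ∀ {σ τ : Trace P} {i k} β → σ i ≡ τ k → σ (suc i) ≡ τ (suc k) →
           σ from i ⊢β β → τ from k ⊢β β
  β-cong (now α)   e e′ h       = α-cong α e h
  β-cong (X α)     e e′ h       = α-cong α e′ h
  β-cong (β and δ) e e′ (h , g) = β-cong β e e′ h , β-cong δ e e′ g
  β-cong (β or δ)  e e′         = map (β-cong β e e′) (β-cong δ e e′)

  -- `G` and `GF` constrain every position, so dropping `d` letters only removes obligations. For
  -- `GF`, the witness found from `l + d` on is itself of the form `n + d`.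
  γ-suffix : ∀ {σ τ : Trace P} d γ → (∀ n → σ (n + d) ≡ τ n) →
             σ from 0 ⊢γ γ → τ from 0 ⊢γ γ
  γ-suffix d (G β)     e h       l _ = β-cong β (e l) (e (suc l)) (h (l + d) z≤n)
  γ-suffix d (GF α)    e h       l _ with h (l + d) z≤n
  ... | m , l+d≤m , g with i+d≤l⇒∃+ l l+d≤m
  ... | n , refl = n , +-cancelʳ-≤ d l n l+d≤m , α-cong α (e n) g
  γ-suffix d (γ and δ) e (h , g) = γ-suffix d γ e h , γ-suffix d δ e g

  LTL-shift : ∀ {f} {σ τ : Trace P} d (φ : LTL P f) i → (∀ n → σ (n + d) ≡ τ n) →
              τ from i ⊢ φ → σ from (i + d) ⊢ φ
  LTL-shift d tt        i e h        = h
  LTL-shift d (atom a)  i e h        = subst (a ∈_) (sym (e i)) h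
  LTL-shift d (¬atom a) i e h        = subst (a ∉_) (sym (e i)) h
  LTL-shift d (φ and ψ) i e (h , g)  = LTL-shift d φ i e h , LTL-shift d ψ i e g
  LTL-shift d (φ or ψ)  i e          = map (LTL-shift d φ i e) (LTL-shift d ψ i e)
  LTL-shift d (X φ)     i e h        = LTL-shift d φ (suc i) e h
  LTL-shift {σ = σ} d (φ U ψ) i e (l , i≤l , h , g) =
    l + d , +-monoˡ-≤ d i≤l , LTL-shift d ψ l e h , before
    where
    before : ∀ k → i + d ≤ k → k < l + d → σ from k ⊢ φ
    before k i+d≤k k<l+d with i+d≤l⇒∃+ i i+d≤k
    ... | m , refl = LTL-shift d φ m e (g m (+-cancelʳ-≤ d i m i+d≤k) (+-cancelʳ-< d m l k<l+d))
  LTL-shift d (G φ) i e h l i+d≤l with i+d≤l⇒∃+ i i+d≤l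
  ... | m , refl = LTL-shift d φ m e (h m (+-cancelʳ-≤ d i m i+d≤l))

  -- Agreement up to `j` suffices, since the finite semantics never looks past `j`: `X` demands
  -- `i < j`. The converse below is needed too, because tightness also asserts that shorter words
  -- fail.
  shift-finite : ∀ {σ τ : Trace P} d φ {i j} → i ≤ j → (∀ n → n ≤ j → σ (n + d) ≡ τ n) →
                 τ [ i ⋯ j ]⊢ φ → σ [ i + d ⋯ j + d ]⊢ φ
  shift-finite d tt        i≤j e h       = h
  shift-finite d (atom a)  i≤j e h       = subst (a ∈_) (sym (e _ i≤j)) h
  shift-finite d (¬atom a) i≤j e h       = subst (a ∉_) (sym (e _ i≤j)) h
  shift-finite d (φ and ψ) i≤j e (h , g) = shift-finite d φ i≤j e h , shift-finite d ψ i≤j e g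
  shift-finite d (φ or ψ)  i≤j e         = map (shift-finite d φ i≤j e) (shift-finite d ψ i≤j e)
  shift-finite d (X φ)     i≤j e (i<j , h) = +-monoˡ-< d i<j , shift-finite d φ i<j e h
  shift-finite {σ} d (φ U ψ) {i} {j} i≤j e (l , i≤l , l≤j , h , g) =
    l + d , +-monoˡ-≤ d i≤l , +-monoˡ-≤ d l≤j , shift-finite d ψ l≤j e h , before
    where
    before : ∀ k → i + d ≤ k → k < l + d → σ [ k ⋯ j + d ]⊢ φ
    before k i+d≤k k<l+d with i+d≤l⇒∃+ i i+d≤k
    ... | m , refl = shift-finite d φ (≤-trans (<⇒≤ m<l) l≤j) e (g m (+-cancelʳ-≤ d i m i+d≤k) m<l)
      where m<l = +-cancelʳ-< d m l k<l+d

  unshift-finite : ∀ {σ τ : Trace P} d φ {i j} → i ≤ j → (∀ n → n ≤ j → σ (n + d) ≡ τ n) →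
                   σ [ i + d ⋯ j + d ]⊢ φ → τ [ i ⋯ j ]⊢ φ
  unshift-finite d tt        i≤j e h       = h
  unshift-finite d (atom a)  i≤j e h       = subst (a ∈_) (e _ i≤j) h
  unshift-finite d (¬atom a) i≤j e h       = subst (a ∉_) (e _ i≤j) h
  unshift-finite d (φ and ψ) i≤j e (h , g) = unshift-finite d φ i≤j e h , unshift-finite d ψ i≤j e g
  unshift-finite d (φ or ψ)  i≤j e         = map (unshift-finite d φ i≤j e) (unshift-finite d ψ i≤j e)
  unshift-finite d (X φ) {i} {j} i≤j e (i<j , h) = i<j′ , unshift-finite d φ i<j′ e h
    where i<j′ = +-cancelʳ-< d i j i<j
  unshift-finite d (φ U ψ) {i} {j} i≤j e (l , i≤l , l≤j , h , g) with i+d≤l⇒∃+ i i≤l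
  ... | m , refl =
    m , +-cancelʳ-≤ d i m i≤l , m≤j , unshift-finite d ψ m≤j e h ,
    λ k i≤k k<m → unshift-finite d φ (≤-trans (<⇒≤ k<m) m≤j) e
                    (g (k + d) (+-monoˡ-≤ d i≤k) (+-monoˡ-< d k<m))
    where m≤j = +-cancelʳ-≤ d m j l≤j

  prefix-cong : ∀ {σ τ : Trace P} φ {n} → (∀ m → m ≤ n → σ m ≡ τ m) →
                σ [ 0 ⋯ n ]⊢ φ → τ [ 0 ⋯ n ]⊢ φ
  prefix-cong {σ} φ {n} e h =
    unshift-finite 0 φ z≤n (λ m m≤n → trans (cong σ (+-identityʳ m)) (e m m≤n))
      (subst (λ k → σ [ 0 ⋯ k ]⊢ φ) (sym (+-identityʳ n)) h)

  extend : Trace P → ℕ → Subset P → Trace P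
  extend u n x m with m ≟ℕ n
  ... | yes _ = x
  ... | no  _ = u m

  extend-agrees : ∀ {u τ : Trace P} {n x} → (∀ m → m < n → u m ≡ τ m) → x ≡ τ n →
                  ∀ m → m ≤ n → extend u n x m ≡ τ m
  extend-agrees {n = n} e e′ m m≤n with m ≟ℕ n
  ... | yes refl = e′
  ... | no  m≢n  = e m (≤∧≢⇒< m≤n m≢n)

-- Monitors are deterministic and, classically, complete

module MonitorProperties (em : ExcludedMiddle 0ℓ) {P : Set} {Pin : Subset P} (D : Monitor Pin) where
  open Monitor D

  -- `Transition` is an arbitrary type, so excluded middle decides whether some guard holds.
  step-total : ∀ c E → ∃[ d ] Step c E d
  step-total (q , θ) E with T? (F q)
  ... | yes q∈F = _ , flagged q∈F
  ... | no  q∉F with q ≟ sink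
  ... | yes refl = _ , sinking
  ... | no  q≢sink with em {∃[ t ] source t ≡ q × guard t E θ ≡ true}
  ... | yes (t , refl , g) = _ , fire t q∉F q≢sink g
  ... | no  none = _ , idle q∉F q≢sink λ t s → ¬-not λ g → none (t , s , g)

  -- The sources are related by an equation because matching two `fire` steps from one configuration
  -- would require unifying `source t` with `source u`.
  step-functional′ : ∀ {c c′ E d d′} → c ≡ c′ → Step c E d → Step c′ E d′ → d ≡ d′
  step-functional′ e (fire {θ} {E} t _ _ g) (fire u _ _ g′)
    with deterministic t u E θ (cong proj₁ e) g (trans (cong (guard u E) (cong proj₂ e)) g′)
  ... | refl = cong (λ ϑ → target t , action t E ϑ) (cong proj₂ e)
  step-functional′ refl (fire t _ _ g) (idle _ _ none) = contradiction (trans (sym g) (none t refl)) λ ()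
  step-functional′ e (fire t _ ≢sink _) sinking        = contradiction (cong proj₁ e) ≢sink
  step-functional′ refl (fire t ∉F _ _) (flagged ∈F)   = contradiction ∈F ∉F
  step-functional′ refl (idle _ _ none) (fire t _ _ g) = contradiction (trans (sym g) (none t refl)) λ ()
  step-functional′ refl (idle _ _ _) (idle _ _ _)      = refl
  step-functional′ refl (idle _ ≢sink _) sinking       = contradiction refl ≢sink
  step-functional′ refl (idle ∉F _ _) (flagged ∈F)     = contradiction ∈F ∉F
  step-functional′ e sinking (fire t _ ≢sink _)        = contradiction (sym (cong proj₁ e)) ≢sink
  step-functional′ refl sinking (idle _ ≢sink _)       = contradiction refl ≢sink
  step-functional′ refl sinking sinking                = refl
  step-functional′ refl sinking (flagged ∈F)           = contradiction ∈F sink∉F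
  step-functional′ refl (flagged ∈F) (fire t ∉F _ _)   = contradiction ∈F ∉F
  step-functional′ refl (flagged ∈F) (idle ∉F _ _)     = contradiction ∈F ∉F
  step-functional′ refl (flagged ∈F) sinking           = contradiction ∈F sink∉F
  step-functional′ refl (flagged _) (flagged _)        = refl

  step-functional : ∀ {c E d d′} → Step c E d → Step c E d′ → d ≡ d′
  step-functional = step-functional′ refl

  sink-stays : ∀ {c E d} → proj₁ c ≡ sink → Step c E d → proj₁ d ≡ sink
  sink-stays q≡sink (fire t _ ≢sink _) = contradiction q≡sink ≢sink
  sink-stays q≡sink (idle _ ≢sink _)   = contradiction q≡sink ≢sink
  sink-stays q≡sink sinking            = refl
  sink-stays q≡sink (flagged _)        = refl

  flag-sinks : ∀ {c E d} → proj₁ c ∈ F → Step c E d → proj₁ d ≡ sink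
  flag-sinks q∈F (fire t ∉F _ _) = contradiction q∈F ∉F
  flag-sinks q∈F (idle ∉F _ _)   = contradiction q∈F ∉F
  flag-sinks q∈F sinking         = refl
  flag-sinks q∈F (flagged _)     = refl

-- The combined machine and its invariants

-- A run of C is abandoned when Done n u holds of the letters u 0, …, u n
-- produced since the flag; the other values of u are junk.

module Controller
  (em : ExcludedMiddle 0ℓ) {P : Set} {Pin Pout : Subset P}
  (D : Monitor Pin) (C : Mealy Pin Pout)
  (Done : ℕ → Trace P → Set)
  (Done-cong : ∀ {n u v} → (∀ m → m ≤ n → u m ≡ v m) → Done n u → Done n v)
  where

  private
    module D = Monitor D
    module C = Mealy C
  open MonitorProperties em D

  data State : Set where
    watching : D.Config → State
    serving  : C.S → ℕ → Trace P → State

  initial : State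
  initial = watching (D.q₀ , D.θ₀)

  current : State → C.S
  current (watching _)    = C.s₀
  current (serving s _ _) = s

  letter : C.S → 2^ Pin → Subset P
  letter s E = set E ∪ set (proj₁ (C.δ s E))

  continue : ∀ {n u} → C.S → Dec (Done n u) → State
  continue         s (yes _) = initial
  continue {n} {u} s (no _)  = serving s (suc n) u

  serve : C.S → ℕ → Trace P → 2^ Pin → State
  serve s n u E = continue (proj₂ (C.δ s E)) (em {Done n (extend u n (letter s E))})

  -- D reads the Pin-part of the produced letter and not the input E itself:
  -- the two differ when Pin and Pout overlap.
  observe : D.Config → 2^ Pin → D.Config
  observe c E = proj₁ (step-total c (letter C.s₀ E restrictedTo Pin))

  nextState : State → 2^ Pin → State
  nextState (serving s n u) E = serve s n u E
  nextState (watching c)    E =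
    -- The letter on which D flags is letter 0 of the run of C; if `Done` holds of it already, the
    -- machine is back in `initial` at once.
    if D.F (proj₁ (observe c E)) then serve C.s₀ 0 (λ _ _ → false) E else watching (observe c E)

  controller : Mealy Pin Pout
  controller = record
    { S  = State
    ; s₀ = initial
    ; δ  = λ x E → proj₁ (C.δ (current x) E) , nextState x E
    ; F  = λ _ → false
    }

  module _ (I : ℕ → 2^ Pin) where
    open Mealy controller using (state; word)

    w : Trace P
    w = word I

    inputsFrom : ℕ → ℕ → 2^ Pin
    inputsFrom j n = I (n + j)

    suffix : ℕ → Trace P
    suffix j n = w (n + j)

    watching-reads : ∀ {j c d} → state I j ≡ watching c → D.Step c (w j restrictedTo Pin) d →
                     observe c (I j) ≡ d
    watching-reads {j} {c} e st rewrite e =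
      step-functional (proj₂ (step-total c (letter C.s₀ (I j) restrictedTo Pin))) st

    watching-continues : ∀ {j c d} → state I j ≡ watching c → D.Step c (w j restrictedTo Pin) d →
                         proj₁ d ∉ D.F → state I (suc j) ≡ watching d
    watching-continues {j} {c} {d} e st d∉F with watching-reads e st
    ... | refl rewrite e with D.F (proj₁ (observe c (I j)))
    ... | true  = contradiction _ d∉F
    ... | false = refl

    watching-flags : ∀ {j c d} → state I j ≡ watching c → D.Step c (w j restrictedTo Pin) d →
                     proj₁ d ∈ D.F → state I (suc j) ≡ serve C.s₀ 0 (λ _ _ → false) (I j)
    watching-flags {j} {c} {d} e st d∈F with watching-reads e st
    ... | refl rewrite e with D.F (proj₁ (observe c (I j)))
    ... | true = refl

    -- At time n + j, the machine makes the n-th step of C on the inputs from j.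
    record Serving (j n : ℕ) : Set where
      field
        history  : Trace P
        recorded : ∀ m → m < n → history m ≡ suffix j m
        -- The state itself is left open: for `n = 0` it is still a watching one.
        current≡ : current (state I (n + j)) ≡ C.state (inputsFrom j) n
        next≡    : state I (suc n + j) ≡ serve (C.state (inputsFrom j) n) n history (I (n + j))

      letter≡ : letter (C.state (inputsFrom j) n) (I (n + j)) ≡ suffix j n
      letter≡ = cong (λ s → letter s (I (n + j))) (sym current≡)

      recorded′ : ∀ m → m ≤ n →
        extend history n (letter (C.state (inputsFrom j) n) (I (n + j))) m ≡ suffix j m
      recorded′ = extend-agrees recorded letter≡

    -- The invariant stays one letter behind D, as the machine stops watching when it reads a
    -- flagging letter. From the next letter on, D is in its sink, whatever the machine does.
    run-watched : ∀ {p j c} → state I p ≡ initial → D.Run w p j c →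
      proj₁ c ≡ D.sink ⊎ (∃[ b ] state I j ≡ watching b × D.Step b (w j restrictedTo Pin) c)
    run-watched e (D.first st) = inj₂ (_ , e , st)
    run-watched e (D.next {c = c} r st) with run-watched e r
    ... | inj₁ c≡sink = inj₁ (sink-stays c≡sink st)
    ... | inj₂ (b , e′ , st′) with T? (D.F (proj₁ c))
    ... | yes c∈F = inj₁ (flag-sinks c∈F st)
    ... | no  c∉F = inj₂ (c , watching-continues e′ st′ c∉F , st)

    flag-serves : ∀ {p j} → state I p ≡ initial → w [ p ⋯ j ]⊩ᴹ D → Serving j 0
    flag-serves e (c , r , c∈F) with run-watched e r
    ... | inj₁ c≡sink = contradiction (subst (_∈ D.F) c≡sink c∈F) D.sink∉F
    ... | inj₂ (b , e′ , st) = record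
      { history  = λ _ _ → false
      ; recorded = λ _ ()
      ; current≡ = cong current e′
      ; next≡    = watching-flags e′ st c∈F
      }

    serving-suc : ∀ {j n} → Serving j n → ¬ Done n (suffix j) → Serving j (suc n)
    serving-suc {j} {n} a ¬done = go em refl
      where
      open Serving a
      s  = C.state (inputsFrom j) n
      u′ = extend history n (letter s (I (n + j)))

      -- The decision made inside `serve` is replaced by a variable `d`; the equation carries the
      -- outcome back to `next≡`.
      go : (d : Dec (Done n u′)) → em ≡ d → Serving j (suc n)
      go (yes done) _  = contradiction (Done-cong recorded′ done) ¬done
      go (no _) em≡no = record
        { history  = u′
        ; recorded = λ { m (s≤s m≤n) → recorded′ m m≤n }
        ; current≡ = cong current state≡
        ; next≡    = cong (λ x → nextState x (I (suc n + j))) state≡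
        }
        where
        state≡ : state I (suc n + j) ≡ serving (C.state (inputsFrom j) (suc n)) (suc n) u′
        state≡ = trans next≡ (cong (continue _) em≡no)

    serving-until : ∀ {j} → Serving j 0 → ∀ n → (∀ m → m < n → ¬ Done m (suffix j)) → Serving j n
    serving-until a zero    _     = a
    serving-until a (suc n) ¬done =
      serving-suc (serving-until a n λ m m<n → ¬done m (m<n⇒m<1+n m<n)) (¬done n ≤-refl)

    serving-done : ∀ {j n} → Serving j n → Done n (suffix j) → state I (suc n + j) ≡ initial
    serving-done {j} {n} a done = trans next≡ (go em)
      where
      open Serving a
      go : ∀ (d : Dec (Done n (extend history n (letter (C.state (inputsFrom j) n) (I (n + j)))))) →
           continue (C.state (inputsFrom j) (suc n)) d ≡ initial
      go (yes _)    = refl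
      go (no ¬done) = contradiction (Done-cong (λ m m≤n → sym (recorded′ m m≤n)) done) ¬done

    never-done⇒word : ∀ {j} → Serving j 0 → (∀ n → ¬ Done n (suffix j)) →
                      ∀ n → w (n + j) ≡ C.word (inputsFrom j) n
    never-done⇒word a ¬done n = sym (Serving.letter≡ (serving-until a n λ m _ → ¬done m))

-- Simple and repeating triggers

module _ (em : ExcludedMiddle 0ℓ) {P : Set} {Pin Pout : Subset P}
         (γ : Assumption P) (D : Monitor Pin) (C : Mealy Pin Pout) where

  simple-trigger : ∀ φ → Realises C (λ w → w from 0 ⊢γ γ → w from 0 ⊢ φ) →
    Σ[ M ∈ Mealy Pin Pout ] Realises M (λ w → w from 0 ⊢γ γ → w from 0 ⊢ D ∶ φ)
  simple-trigger φ realises = controller , proof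
    where
    -- With `Done` empty, the run of C begun at the flag goes on forever.
    open Controller em D C (λ _ _ → ⊥) (λ _ ())

    proof : Realises controller (λ w → w from 0 ⊢γ γ → w from 0 ⊢ D ∶ φ)
    proof I assumed j _ flags = LTL-shift j φ 0 same (realises (inputsFrom I j) (γ-suffix j γ same assumed))
      where same = never-done⇒word I (flag-serves I refl flags) λ _ ()

  repeating-trigger : ∀ φ → TightlyRealises C γ φ →
    Σ[ M ∈ Mealy Pin Pout ] Realises M (λ w → w from 0 ⊢γ γ → w ⊢⟨ D ⨾ φ ⟩*)
  repeating-trigger φ (_ , tight) = controller , proof
    where
    open Controller em D C (λ n u → u [ 0 ⋯ n ]⊢ φ) (prefix-cong φ)
    open Mealy controller using (state)

    -- Tightness of the match from `j` to `n + j` says exactly that `Done` fails before step `n` and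
    -- holds at step `n`, so the machine resets just after the match.
    restart-initial : ∀ I {p} → RestartPoint (w I) D φ p → state I p ≡ initial
    restart-initial I start = refl
    restart-initial I (restart r (j , _ , j≤k , flags , sat , least)) with ≤⇒∃+ j≤k
    ... | n , refl = serving-done I
      (serving-until I (flag-serves I (restart-initial I r) flags) n λ m m<n sat′ →
        least (m + j) (m≤n+m j m) (+-monoˡ-< j m<n) (shift-finite j φ z≤n (λ _ _ → refl) sat′))
      (unshift-finite j φ z≤n (λ _ _ → refl) sat)

    proof : Realises controller (λ w → w from 0 ⊢γ γ → w ⊢⟨ D ⨾ φ ⟩*)
    proof I assumed p r i p≤i flags with em {∃[ n ] w I [ i ⋯ n + i ]⊩ φ}
    ... | yes (n , sat) = n + i , m≤n+m i n , i , p≤i , m≤n+m i n , flags , sat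
    -- Without a tight match the run of C is never abandoned, so the suffix from `i` is a word of C
    -- satisfying `γ`. The hypothesis on C then yields a prefix satisfying `φ`, which `never`
    -- excludes.
    ... | no  none =
      let n , _ , (sat , _) , _ = tight (inputsFrom I i) (γ-suffix i γ same assumed)
      in contradiction (prefix-cong φ (λ m _ → sym (same m)) sat) (never n)
      where
      -- A shortest prefix satisfying `φ` would be a tight match, so strong induction excludes every
      -- such prefix.
      never-step : ∀ n → (∀ {m} → m < n → ¬ (suffix I i [ 0 ⋯ m ]⊢ φ)) → ¬ (suffix I i [ 0 ⋯ n ]⊢ φ)
      never-step n ih sat = none (n , shift-finite i φ z≤n (λ _ _ → refl) sat , earlier)
        where
        earlier : ∀ k → i ≤ k → k < n + i → ¬ (w I [ i ⋯ k ]⊢ φ)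
        earlier k i≤k k<n+i sat′ with ≤⇒∃+ i≤k
        ... | m , refl = ih (+-cancelʳ-< i m n k<n+i) (unshift-finite i φ z≤n (λ _ _ → refl) sat′)

      never : ∀ n → ¬ (suffix I i [ 0 ⋯ n ]⊢ φ)
      never = <-rec _ never-step

      same : ∀ n → w I (n + i) ≡ Mealy.word C (inputsFrom I i) n
      same = never-done⇒word I (flag-serves I (restart-initial I r) flags) never

theorem4 : ExcludedMiddle 0ℓ →
    (P : Set) (Pin Pout : Subset P) → (∀ p → p ∈ Pin ∪ Pout) →
    (γ : Assumption P) (D : Monitor Pin) →
    ((φ : LTL P full) (C : Mealy Pin Pout) →
    Realises C (λ w → w from 0 ⊢γ γ → w from 0 ⊢ φ) →
    Σ[ M ∈ Mealy Pin Pout ] Realises M (λ w → w from 0 ⊢γ γ → w from 0 ⊢ D ∶ φ))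
    ×
    ((φ : LTL P co-safety) (C : Mealy Pin Pout) →
    TightlyRealises C γ φ →
    Σ[ M ∈ Mealy Pin Pout ] Realises M (λ w → w from 0 ⊢γ γ → w ⊢⟨ D ⨾ φ ⟩*))
theorem4 em P Pin Pout _ γ D =
  (λ φ C → simple-trigger em γ D C φ) , (λ φ C → repeating-trigger em γ D C φ)
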